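{- Let $G$ be a bridgeless graph with diameter $2$. Then $rc(G)\leq 5$.
   Context: All graphs are finite, simple and undirected; a graph is bridgeless if no edge's removal disconnects it. In an edge-colored graph (adjacent edges may receive the same color), a path is a rainbow path if no two of its edges have the same color. The rainbow connection number $rc(G)$ of a connected graph $G$ is the minimum integer $i$ such that there is an edge-coloring of $G$ with $i$ colors in which every two distinct vertices of $G$ are connected by a rainbow path. -}

module Defs where

open import Data.Nat using (ℕ; zero; suc; _≤_; _<_)
open import Data.Fin using (Fin)
open import Data.Bool using (Bool; true; false; _∧_; not)
open import Data.List using (List; []; _∷_)
open import Data.List.Relation.Unary.Unique.Propositional using (Unique)
open import Data.Product using (Σ; ∃; ∃-syntax; _×_; _,_)
open import Relation.Binary.PropositionalEquality using (_≡_)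
open import Relation.Nullary using (¬_)

record Graph : Set where
  field
    n      : ℕ
    adj    : Fin n → Fin n → Bool
    sym    : ∀ u v → adj u v ≡ adj v u
    irrefl : ∀ v → adj v v ≡ false
open Graph public

Vertex : Graph → Set
Vertex G = Fin (n G)

Adj : (G : Graph) → Vertex G → Vertex G → Set
Adj G u v = adj G u v ≡ true

data Walk (G : Graph) : Vertex G → Vertex G → Set where
  []  : ∀ {u} → Walk G u u
  _∷_ : ∀ {u w v} → Adj G u w → Walk G w v → Walk G u v

length : ∀ {G u v} → Walk G u v → ℕ
length []      = zero
length (_ ∷ p) = suc (length p)

vertices : ∀ {G u v} → Walk G u v → List (Vertex G)
vertices {u = u} []               = u ∷ []
vertices {u = u} (_ ∷ p)          = u ∷ vertices p

IsPath : ∀ {G u v} → Walk G u v → Set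
IsPath p = Unique (vertices p)

DistLe : (G : Graph) → Vertex G → Vertex G → ℕ → Set
DistLe G u v d = Σ (Walk G u v) λ p → IsPath p × length p ≤ d

Connected : Graph → Set
Connected G = ∀ u v → Σ (Walk G u v) IsPath

HasDiameter : Graph → ℕ → Set
HasDiameter G d =
  Connected G ×
  (∀ u v → DistLe G u v d) ×
  (∃[ u ] ∃[ v ] (∀ (p : Walk G u v) → IsPath p → ¬ (length p < d)))

removeEdge : (G : Graph) → Vertex G → Vertex G → Graph
removeEdge G a b = record
  { n      = n G
  ; adj    = λ u v → adj G u v ∧ not (isAB u v)
  ; sym    = symProof
  ; irrefl = λ v → irr v
  }
  where
  open import Data.Fin using (_≟_)
  open import Relation.Nullary.Decidable using (⌊_⌋)
  open import Data.Bool using (_∨_)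
  open import Data.Bool.Properties using (∨-comm)
  open import Relation.Binary.PropositionalEquality using (cong₂; refl)
  isAB : Fin (n G) → Fin (n G) → Bool
  isAB u v = (⌊ u ≟ a ⌋ ∧ ⌊ v ≟ b ⌋) ∨ (⌊ u ≟ b ⌋ ∧ ⌊ v ≟ a ⌋)
  isAB-sym : ∀ u v → isAB u v ≡ isAB v u
  isAB-sym u v with ⌊ u ≟ a ⌋ | ⌊ v ≟ b ⌋ | ⌊ u ≟ b ⌋ | ⌊ v ≟ a ⌋
  ... | x | y | z | w with x | y | z | w
  ... | true  | true  | true  | true  = refl
  ... | true  | true  | true  | false = refl
  ... | true  | true  | false | true  = refl
  ... | true  | true  | false | false = refl
  ... | true  | false | true  | true  = refl
  ... | true  | false | true  | false = refl
  ... | true  | false | false | true  = refl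
  ... | true  | false | false | false = refl
  ... | false | true  | true  | true  = refl
  ... | false | true  | true  | false = refl
  ... | false | true  | false | true  = refl
  ... | false | true  | false | false = refl
  ... | false | false | true  | true  = refl
  ... | false | false | true  | false = refl
  ... | false | false | false | true  = refl
  ... | false | false | false | false = refl
  symProof : ∀ u v → (adj G u v ∧ not (isAB u v)) ≡ (adj G v u ∧ not (isAB v u))
  symProof u v = cong₂ (λ x y → x ∧ not y) (sym G u v) (isAB-sym u v)
  irr : ∀ v → (adj G v v ∧ not (isAB v v)) ≡ false
  irr v with adj G v v | irrefl G v
  ... | .false | refl = refl

IsBridge : (G : Graph) → Vertex G → Vertex G → Set
IsBridge G u v = Adj G u v × ¬ Connected (removeEdge G u v)

Bridgeless : Graph → Set
Bridgeless G = ∀ u v → ¬ IsBridge G u v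

-- Edge colorings with k colors: a symmetric map on vertex pairs
-- (only its values on edges matter).
record EdgeColoring (G : Graph) (k : ℕ) : Set where
  field
    color     : Vertex G → Vertex G → Fin k
    color-sym : ∀ u v → color u v ≡ color v u
open EdgeColoring public

edgeColors : ∀ {G k u v} → EdgeColoring G k → Walk G u v → List (Fin k)
edgeColors c []                         = []
edgeColors {u = u} c (_∷_ {w = w} _ p)  = color c u w ∷ edgeColors c p

IsRainbowPath : ∀ {G k u v} → EdgeColoring G k → Walk G u v → Set
IsRainbowPath c p = IsPath p × Unique (edgeColors c p)

RainbowConnecting : ∀ {G k} → EdgeColoring G k → Set
RainbowConnecting {G} c =
  ∀ (u v : Vertex G) → ¬ u ≡ v → Σ (Walk G u v) (IsRainbowPath c)

RcLe : Graph → ℕ → Set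
RcLe G k = Σ (EdgeColoring G k) RainbowConnecting

{-# OPTIONS --safe #-}
module Submission where

-- Choose v with N[v] maximal under inclusion. Let N be its neighbours, F the vertices at distance 2, and
-- split N into two sides X and Y. Edges vX and vY get colours 1 and 2, XF and YF colours 3 and 4, and all
-- others colour 5. Suppose each u ≠ v has, for its side X (or symmetrically Y), a route from v coloured in a
-- set S ∈ {{1}, {1,3}} and another one avoiding S. Then any two vertices are joined by a rainbow walk through
-- v: short–short routes for different sides, short–long for equal sides.
--
-- Such routes exist when every x ∈ N has a neighbour in F or across the split, and every a ∈ F with all its
-- N-neighbours on one side either has a neighbour in F touching the other side, or has two N-neighbours, one
-- of which (x′) has a neighbour across the split; in the last case the colour of the edge ax′ is switched to
-- that of the other side. To find the split, let T ⊆ N be the vertices with a neighbour in F. Since the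
-- diameter is 2, each vertex of N ∖ T has a neighbour in T (if F ≠ ∅) and can be put opposite to it. On T,
-- take a split in which each vertex with a non-neighbour in T has one across, and with both sides non-empty
-- if T has two elements. If x is the only N-neighbour of a ∈ F, maximality of N[v] gives x a non-neighbour
-- in N, which lies in T because it is at distance 2 from a; the one across is then joined to a through F.
-- If F = ∅, bridgelessness lets each vertex of N have a neighbour across.

open import Defs
open import Data.Bool using (Bool; true; false; not; _xor_; if_then_else_)
open import Data.Bool.Properties using (¬-not; not-involutive) renaming (_≟_ to _≟ᵇ_)
open import Data.Empty using (⊥; ⊥-elim)
open import Data.Fin using (Fin; zero; suc; _≟_)
open import Data.Fin.Patterns using (0F; 1F; 2F; 3F; 4F)
open import Data.Fin.Properties using (any?)
open import Data.Fin.Subset using (Subset; _⊂_; _⊃_) renaming (_∈_ to _∈ˢ_)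
open import Data.Fin.Subset.Induction using (⊃-wellFounded; Acc; acc)
open import Data.Fin.Subset.Properties using (_⊂?_)
open import Data.List using (List; []; _∷_)
open import Data.List.Membership.DecPropositional {A = Fin 5} _≟_ using () renaming (_∈?_ to _∈ᶜ?_)
import Data.List.Membership.DecPropositional as DecMembership
open import Data.List.Membership.Propositional using (_∈_; _∉_)
open import Data.List.Relation.Binary.Disjoint.Propositional using (Disjoint)
open import Data.List.Relation.Binary.Subset.Propositional using (_⊆_)
open import Data.List.Relation.Unary.All as All using (All; []; _∷_)
open import Data.List.Relation.Unary.All.Properties using (¬Any⇒All¬; All¬⇒¬Any; anti-mono)
open import Data.List.Relation.Unary.AllPairs using ([]; _∷_)
open import Data.List.Relation.Unary.Any using (here; there)
open import Data.List.Relation.Unary.Unique.DecPropositional {A = Fin 5} _≟_ using (unique?)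
open import Data.List.Relation.Unary.Unique.Propositional using (Unique)
open import Data.Nat using (ℕ; zero; suc; s≤s)
open import Data.Product using (Σ; ∃-syntax; _×_; _,_; proj₁; proj₂)
open import Data.Sum using (_⊎_; inj₁; inj₂)
open import Data.Vec using (tabulate)
open import Data.Vec.Properties using (lookup∘tabulate; lookup⇒[]=; []=⇒lookup)
open import Function using (_∘_; id; case_of_)
open import Level using (0ℓ)
open import Relation.Binary.Core using (Rel)
open import Relation.Binary.Definitions using (Symmetric; Irreflexive; Decidable)
open import Relation.Binary.PropositionalEquality
  using (_≡_; _≢_; refl; trans; cong; cong₂; subst; ≢-sym)
  renaming (sym to ≡-sym)
open import Relation.Nullary using (¬_; Dec; yes; no; does)
open import Relation.Nullary.Decidable
  using (True; toWitness; decidable-stable; dec-true; dec-false; ¬?; _×-dec_; _⊎-dec_)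
open import Relation.Unary using () renaming (Decidable to Decidable₁)

-- Rainbow walks and their composition into rainbow paths.

module _ {G : Graph} {k : ℕ} (c : EdgeColoring G k) where

  open DecMembership (_≟_ {n G}) using (_∈?_)

  Rainbow : ∀ {u v} → Walk G u v → Set
  Rainbow p = Unique (edgeColors c p)

  dropUntil : ∀ {u v w} (p : Walk G u v) → w ∈ vertices p → IsPath p → Rainbow p →
              Σ (Walk G w v) λ q → IsRainbowPath c q × edgeColors c q ⊆ edgeColors c p
  dropUntil []      (here refl) path rb = [] , (path , rb) , id
  dropUntil (e ∷ p) (here refl) path rb = e ∷ p , (path , rb) , id
  dropUntil (e ∷ p) (there w∈p) (_ ∷ path) (_ ∷ rb) =
    let q , rbq , q⊆p = dropUntil p w∈p path rb in q , rbq , there ∘ q⊆p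

  -- Cutting out closed detours only deletes colours. The inclusion in the conclusion keeps the
  -- first colour of a walk distinct from those of the shortened remainder.
  toPath : ∀ {u v} (p : Walk G u v) → Rainbow p →
           Σ (Walk G u v) λ q → IsRainbowPath c q × edgeColors c q ⊆ edgeColors c p
  toPath [] rb = [] , ([] ∷ [] , rb) , id
  toPath {u} (e ∷ p) (c∉p ∷ rb) with toPath p rb
  ... | q , (path , rbq) , q⊆p with u ∈? vertices q
  ...   | yes u∈q = let q′ , rbq′ , q′⊆q = dropUntil q u∈q path rbq in q′ , rbq′ , there ∘ q⊆p ∘ q′⊆q
  ...   | no  u∉q = e ∷ q , (¬Any⇒All¬ _ u∉q ∷ path , anti-mono q⊆p c∉p ∷ rbq) ,
                    λ { (here eq) → here eq ; (there x∈q) → there (q⊆p x∈q) }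

  -- `p` is reversed edge by edge onto `q`. As `p` is rainbow and shares no colour with `q`, each
  -- transferred colour is new to `q` and does not occur in the rest of `p`.
  join : ∀ {u v w} (p : Walk G v u) (q : Walk G v w) → Rainbow p → Rainbow q →
         Disjoint (edgeColors c p) (edgeColors c q) → Σ (Walk G u w) Rainbow
  join [] q rp rq dis = q , rq
  join {v = v} (_∷_ {w = x} e p) q (c∉p ∷ rp) rq dis =
    join p (trans (sym G x v) e ∷ q) rp (¬Any⇒All¬ _ x∉q ∷ rq)
      λ { (y∈p , here refl) → All¬⇒¬Any c∉p (subst (_∈ edgeColors c p) (color-sym c x v) y∈p)
        ; (y∈p , there y∈q) → dis (there y∈p , y∈q) }
    where
    x∉q : color c x v ∉ edgeColors c q
    x∉q m = dis (here (color-sym c x v) , m)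

  connect : ∀ {u v w} {P Q : Fin k → Set} (p : Walk G v u) (q : Walk G v w) → Rainbow p → Rainbow q →
            All P (edgeColors c p) → All Q (edgeColors c q) → (∀ {x} → P x → ¬ Q x) →
            Σ (Walk G u w) (IsRainbowPath c)
  connect p q rp rq ap aq P⇒¬Q =
    let r , rb = join p q rp rq λ (x∈p , x∈q) → P⇒¬Q (All.lookup ap x∈p) (All.lookup aq x∈q)
        s , rs , _ = toPath r rb
    in s , rs

-- Splits from maximal independent sets.

-- The membership function of a maximal independent set.
kernel : ∀ {n} (R : Rel (Fin n) 0ℓ) → Symmetric R → Irreflexive _≡_ R → Decidable R →
         Σ (Fin n → Bool) λ f → ∀ {u} →
           (f u ≡ true → ∀ {w} → R u w → f w ≡ false) × (f u ≡ false → ∃[ w ] R u w × f w ≡ true)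
kernel {zero} R _ _ _ = (λ ()) , λ { {()} }
kernel {suc n} R symR irr R? with kernel {n} (λ u w → R (suc u) (suc w)) symR (λ { refl → irr refl }) (λ u w → R? (suc u) (suc w))
... | f , ker with any? (λ w → R? zero (suc w) ×-dec f w ≟ᵇ true)
... | yes (w , r , fw) = g , λ {u} → ind u , dom u
  where
  g : Fin (suc n) → Bool
  g zero    = false
  g (suc i) = f i
  ind : ∀ u → g u ≡ true → ∀ {x} → R u x → g x ≡ false
  ind (suc u) eq {zero}  r = refl
  ind (suc u) eq {suc x} r = proj₁ ker eq r
  dom : ∀ u → g u ≡ false → ∃[ x ] R u x × g x ≡ true
  dom zero    _  = suc w , r , fw
  dom (suc u) eq = let x , r , fx = proj₂ ker eq in suc x , r , fx
... | no none = g , λ {u} → ind u , dom u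
  where
  g : Fin (suc n) → Bool
  g zero    = true
  g (suc i) = f i
  ind : ∀ u → g u ≡ true → ∀ {x} → R u x → g x ≡ false
  ind zero    _  {zero}  r = ⊥-elim (irr refl r)
  ind zero    _  {suc x} r = ¬-not λ fx → none (x , r , fx)
  ind (suc u) eq {zero}  r = ⊥-elim (none (u , symR r , eq))
  ind (suc u) eq {suc x} r = proj₁ ker eq r
  dom : ∀ u → g u ≡ false → ∃[ x ] R u x × g x ≡ true
  dom (suc u) eq = let x , r , fx = proj₂ ker eq in suc x , r , fx

-- A member of a maximal independent set has all its `R`-neighbours outside, and a non-member has
-- one inside.
bipartition : ∀ {n} (R : Rel (Fin n) 0ℓ) → Symmetric R → Irreflexive _≡_ R → Decidable R →
              Σ (Fin n → Bool) λ f → ∀ {u w} → R u w → ∃[ x ] R u x × f x ≡ not (f u)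
bipartition R symR irr R? with kernel R symR irr R?
... | f , ker = f , opposite
  where
  opposite : ∀ {u w} → R u w → ∃[ x ] R u x × f x ≡ not (f u)
  opposite {u} r with f u in eq
  ... | true  = _ , r , proj₁ ker eq r
  ... | false = proj₂ ker eq

-- The five colours and the colour sets of the routes.

data Layer : Set where
  centre near far : Layer

_≟ₗ_ : Decidable {A = Layer} _≡_
centre ≟ₗ centre = yes refl
centre ≟ₗ near   = no λ ()
centre ≟ₗ far    = no λ ()
near   ≟ₗ centre = no λ ()
near   ≟ₗ near   = yes refl
near   ≟ₗ far    = no λ ()
far    ≟ₗ centre = no λ ()
far    ≟ₗ near   = no λ ()
far    ≟ₗ far    = yes refl

inner outer : Bool → Fin 5
inner false = 0F
inner true  = 1F
outer false = 2F
outer true  = 3F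

mid : Fin 5
mid = 4F

-- The sets S of the overview, together with the empty set for `v`, where the empty walk serves as
-- both routes.
palette : Layer → Bool → List (Fin 5)
palette centre s = []
palette near   s = inner s ∷ []
palette far    s = inner s ∷ outer s ∷ []

-- For two vertices with the same side, the short route is taken to the one with the smaller palette
-- and the long route to the other; nesting makes their colours disjoint.
palette-total : ∀ l m s → palette l s ⊆ palette m s ⊎ palette m s ⊆ palette l s
palette-total centre m      s = inj₁ λ ()
palette-total l      centre s = inj₂ λ ()
palette-total near   near   s = inj₁ id
palette-total near   far    s = inj₁ λ { (here eq) → here eq }
palette-total far    near   s = inj₂ λ { (here eq) → here eq }
palette-total far    far    s = inj₁ id

palette-⊆-far : ∀ l s → palette l s ⊆ palette far s
palette-⊆-far near s (here eq) = here eq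
palette-⊆-far far  s x∈        = x∈

palette-far-disjoint : ∀ s → Disjoint (palette far s) (palette far (not s))
palette-far-disjoint false (here refl , there (here ()))
palette-far-disjoint false (there (here refl) , there (here ()))
palette-far-disjoint true  (here refl , there (here ()))
palette-far-disjoint true  (there (here refl) , there (here ()))

Inside Outside : Layer → (Bool → List (Fin 5)) → Bool → Set
Inside  l cs s = Unique (cs s) × All (_∈ palette l s) (cs s)
Outside l cs s = Unique (cs s) × All (_∉ palette l s) (cs s)

inside? : ∀ l cs s → Dec (Inside l cs s)
inside? l cs s = unique? (cs s) ×-dec All.all? (_∈ᶜ? palette l s) (cs s)

outside? : ∀ l cs s → Dec (Outside l cs s)
outside? l cs s = unique? (cs s) ×-dec All.all? (λ x → ¬? (x ∈ᶜ? palette l s)) (cs s)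

-- Colour lists of routes are written as functions of the side, so their distinctness and palette
-- conditions are settled by evaluation at the two Booleans.
both : ∀ {P : Bool → Set} (P? : ∀ s → Dec (P s)) {_ : True (P? false)} {_ : True (P? true)} → ∀ s → P s
both P? {pf} {pt} false = toWitness pf
both P? {pf} {pt} true  = toWitness pt

module _ (G : Graph) where

  adj-sym : ∀ {u w} → Adj G u w → Adj G w u
  adj-sym {u} {w} e = trans (sym G w u) e

  adj⇒≢ : ∀ {u w} → Adj G u w → u ≢ w
  adj⇒≢ {u} e refl = case trans (≡-sym e) (irrefl G u) of λ ()

-- Layers around a vertex and the types of far vertices.

module Distance (G : Graph) (v : Vertex G) where

  -- `far` covers every vertex neither equal nor adjacent to `v`; only the diameter bound turns this
  -- into distance 2.
  level : Vertex G → Layer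
  level u = if does (u ≟ v) then centre else if adj G v u then near else far

  Near Far : Vertex G → Set
  Near u = level u ≡ near
  Far  u = level u ≡ far

  level-centre : level v ≡ centre
  level-centre rewrite dec-true (v ≟ v) refl = refl

  adj⇒near : ∀ {u} → Adj G v u → Near u
  adj⇒near {u} e with u ≟ v
  ... | yes refl = case trans (≡-sym e) (irrefl G v) of λ ()
  ... | no _ rewrite e = refl

  near⇒adj : ∀ {u} → Near u → Adj G v u
  near⇒adj {u} eq with u ≟ v | adj G v u
  ... | no _ | true = refl

  far⇒≢ : ∀ {u} → Far u → u ≢ v
  far⇒≢ {u} eq with u ≟ v
  ... | no u≢v = u≢v

  far⇒¬adj : ∀ {u} → Far u → ¬ Adj G v u
  far⇒¬adj eq e = case trans (≡-sym eq) (adj⇒near e) of λ ()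

  classify : ∀ u → u ≡ v ⊎ Near u ⊎ Far u
  classify u with u ≟ v | adj G v u
  ... | yes u≡v | _     = inj₁ u≡v
  ... | no _    | true  = inj₂ (inj₁ refl)
  ... | no _    | false = inj₂ (inj₂ refl)

  _≟ˡ_ : ∀ u l → Dec (level u ≡ l)
  u ≟ˡ l = level u ≟ₗ l

-- The colours 1, 2, 3, 4 are inner false, inner true, outer false, outer true; f is the indicator of Y.
module Sides (G : Graph) (v : Vertex G) (f : Vertex G → Bool) where

  open Distance G v public

  Opposite : Vertex G → Vertex G → Set
  Opposite y x = f y ≡ not (f x)

  Monochromatic : Vertex G → Bool → Set
  Monochromatic a s = ∀ {z} → Near z → Adj G a z → f z ≡ s

  -- The colouring depends on the constructor chosen for `a`, so the witnesses are stored and all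
  -- routes share them. `notFar` makes the choice total in `a`.
  data Kind (a : Vertex G) : Set where
    notFar  : ¬ Far a → Kind a
    mixed   : ∀ x y → Near x → Near y → Adj G a x → Adj G a y → Opposite y x → Kind a
    linked  : ∀ x b y → Near x → Far b → Near y → Adj G a x → Adj G a b → Adj G b y →
              Opposite y x → Monochromatic a (f x) → Kind a
    doubled : ∀ x x′ y → x ≢ x′ → Near x → Near x′ → Near y → Adj G a x → Adj G a x′ → Adj G x′ y →
              Opposite y x → Monochromatic a (f x) → Kind a

  twist : ∀ {a} → Kind a → Vertex G → Bool
  twist (doubled _ x′ _ _ _ _ _ _ _ _ _ _) z = does (z ≟ x′)
  twist _                                  z = false

-- The colouring of a good split and the two routes to each vertex.

module Routes (G : Graph) (v : Vertex G) (f : Vertex G → Bool)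
              (kind : ∀ a → Sides.Kind G v f a)
              (opp : ∀ x → Distance.Near G v x →
                     (∃[ y ] Distance.Near G v y × Adj G x y × Sides.Opposite G v f y x) ⊎
                     (∃[ a ] Distance.Far G v a × Adj G x a)) where

  open Sides G v f

  -- `xor` with `twist` switches the outer colour of the chosen edge at a `doubled` vertex. The
  -- catch-all gives `mid` to edges inside a layer, and a harmless value to `centre`-`far` pairs,
  -- which are never adjacent.
  colour : Layer → Layer → Vertex G → Vertex G → Fin 5
  colour centre near   u w = inner (f w)
  colour near   centre u w = inner (f u)
  colour near   far    u w = outer (f u xor twist (kind w) u)
  colour far    near   u w = outer (f w xor twist (kind u) w)
  colour _      _      u w = mid

  colour-sym : ∀ l m u w → colour l m u w ≡ colour m l w u
  colour-sym centre centre u w = refl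
  colour-sym centre near   u w = refl
  colour-sym centre far    u w = refl
  colour-sym near   centre u w = refl
  colour-sym near   near   u w = refl
  colour-sym near   far    u w = refl
  colour-sym far    centre u w = refl
  colour-sym far    near   u w = refl
  colour-sym far    far    u w = refl

  c : EdgeColoring G 5
  c = record { color     = λ u w → colour (level u) (level w) u w
             ; color-sym = λ u w → colour-sym (level u) (level w) u w }

  flip : ∀ {u w} → Adj G u w → Adj G w u
  flip = adj-sym G

  col-centre : ∀ x {s} → Near x → f x ≡ s → color c v x ≡ inner s
  col-centre x nx refl rewrite level-centre | nx = refl

  col-near : ∀ x y → Near x → Near y → color c x y ≡ mid
  col-near x y nx ny rewrite nx | ny = refl

  col-far : ∀ a b → Far a → Far b → color c a b ≡ mid
  col-far a b fa fb rewrite fa | fb = refl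

  col-plain : ∀ x a {s} → Near x → Far a → twist (kind a) x ≡ false → f x ≡ s → color c x a ≡ outer s
  col-plain x a nx fa t refl rewrite nx | fa | t with f x
  ... | false = refl
  ... | true  = refl

  col-twisted : ∀ x a {s} → Near x → Far a → twist (kind a) x ≡ true → f x ≡ s → color c x a ≡ outer (not s)
  col-twisted x a nx fa t refl rewrite nx | fa | t with f x
  ... | false = refl
  ... | true  = refl

  Route : Vertex G → (Fin 5 → Set) → Set
  Route u P = Σ (Walk G v u) λ p → Rainbow c p × All P (edgeColors c p)

  infixr 5 _◂_
  _◂_ : ∀ {x y : Fin 5} {xs ys : List (Fin 5)} → x ≡ y → xs ≡ ys → x ∷ xs ≡ y ∷ ys
  _◂_ = cong₂ _∷_

  short : ∀ {u} l cs s {_ : True (inside? l cs false)} {_ : True (inside? l cs true)} →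
          (p : Walk G v u) → edgeColors c p ≡ cs s → Route u (_∈ palette l s)
  short l cs s {pf} {pt} p eq =
    p , subst (λ xs → Unique xs × All _ xs) (≡-sym eq) (both (inside? l cs) {pf} {pt} s)

  long : ∀ {u} l cs s {_ : True (outside? l cs false)} {_ : True (outside? l cs true)} →
         (p : Walk G v u) → edgeColors c p ≡ cs s → Route u (_∉ palette l s)
  long l cs s {pf} {pt} p eq =
    p , subst (λ xs → Unique xs × All _ xs) (≡-sym eq) (both (outside? l cs) {pf} {pt} s)

  Spread : Vertex G → Set
  Spread u = ∃[ l ] ∃[ s ] Route u (_∈ palette l s) × Route u (_∉ palette l s)

  -- A route passing through a far vertex needs an edge there with its ordinary colour. If the
  -- vertex is `doubled`, its edge to `y` may be the switched one, but the stored `x` lies on the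
  -- same side and its edge is not switched.
  untwisted : ∀ {a y} → Far a → Near y → Adj G a y →
              ∃[ z ] Near z × Adj G a z × f z ≡ f y × twist (kind a) z ≡ false
  untwisted {a} {y} fa ny e with kind a
  ... | notFar ¬fa = ⊥-elim (¬fa fa)
  ... | mixed _ _ _ _ _ _ _ = y , ny , e , refl , refl
  ... | linked _ _ _ _ _ _ _ _ _ _ _ = y , ny , e , refl , refl
  ... | doubled x x′ _ x≢x′ nx _ _ ax _ _ _ mono =
        x , nx , ax , ≡-sym (mono ny e) , dec-false (x ≟ x′) x≢x′

  spread-near : ∀ x → Near x → Spread x
  spread-near x nx = near , f x ,
    short near (λ s → inner s ∷ []) (f x) (near⇒adj nx ∷ []) (col-centre x nx refl ◂ refl) , far-route (opp x nx)
    where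
    via : ∀ y → Near y → Adj G x y → Opposite y x → Route x (_∉ palette near (f x))
    via y ny e o = long near (λ s → inner (not s) ∷ mid ∷ []) (f x) (near⇒adj ny ∷ flip e ∷ [])
                   (col-centre y ny o ◂ col-near y x ny nx ◂ refl)

    viaMixed : ∀ a y → Far a → Adj G x a → Near y → Adj G a y → Opposite y x →
               (∀ z → twist (kind a) z ≡ false) → Route x (_∉ palette near (f x))
    viaMixed a y fa e ny e′ o t =
      long near (λ s → inner (not s) ∷ outer (not s) ∷ outer s ∷ []) (f x)
        (near⇒adj ny ∷ flip e′ ∷ flip e ∷ [])
        (col-centre y ny o ◂ col-plain y a ny fa (t _) o ◂
         trans (color-sym c a x) (col-plain x a nx fa (t _) refl) ◂ refl)

    far-route : _ → Route x (_∉ palette near (f x))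
    far-route (inj₁ (y , ny , e , o)) = via y ny e o
    far-route (inj₂ (a , fa , e)) with kind a in eq
    ... | notFar ¬fa = ⊥-elim (¬fa fa)
    -- As `a` has near neighbours on both sides, one of `z` and `y` is opposite `x`.
    ... | mixed z y nz ny az ay o with f x ≟ᵇ f z
    ...   | yes xz = viaMixed a y fa e ny ay (trans o (cong not (≡-sym xz))) (λ z → cong (λ k → twist k z) eq)
    ...   | no ¬xz = viaMixed a z fa e nz az (≡-sym (trans (cong not (¬-not ¬xz)) (not-involutive _)))
                       (λ z → cong (λ k → twist k z) eq)
    far-route (inj₂ (a , fa , e)) | linked z b y nz fb ny az ab by o mono
      with untwisted fb ny by
    ... | y′ , ny′ , by′ , o′ , t =
      long near (λ s → inner (not s) ∷ outer (not s) ∷ mid ∷ outer s ∷ []) (f x)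
        (near⇒adj ny′ ∷ flip by′ ∷ flip ab ∷ flip e ∷ [])
        (col-centre y′ ny′ oy ◂ col-plain y′ b ny′ fb t oy ◂ col-far b a fb fa ◂
         trans (color-sym c a x) (col-plain x a nx fa (cong (λ k → twist k x) eq) refl) ◂ refl)
      where
      oy : Opposite y′ x
      oy = trans o′ (trans o (cong not (≡-sym (mono nx (flip e)))))
    far-route (inj₂ (a , fa , e)) | doubled z x′ y _ nz nx′ ny az ax′ x′y o mono with x ≟ x′
    ... | yes refl = via y ny x′y (trans o (cong not (≡-sym (mono nx (flip e)))))
    -- The route enters `a` from `x′` and leaves to `x`, both on one side. Only the switch at `x′`
    -- keeps these two outer colours distinct.
    ... | no x≢x′ =
      long near (λ s → inner (not s) ∷ mid ∷ outer (not s) ∷ outer s ∷ []) (f x)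
        (near⇒adj ny ∷ flip x′y ∷ flip ax′ ∷ flip e ∷ [])
        (col-centre y ny (trans o (cong not (≡-sym xz))) ◂ col-near y x′ ny nx′ ◂
         col-twisted x′ a nx′ fa (trans (cong (λ k → twist k x′) eq) (dec-true (x′ ≟ x′) refl))
           (trans (mono nx′ ax′) (≡-sym xz)) ◂
         trans (color-sym c a x)
           (col-plain x a nx fa (trans (cong (λ k → twist k x) eq) (dec-false (x ≟ x′) x≢x′)) refl) ◂ refl)
      where
      xz : f x ≡ f z
      xz = mono nx (flip e)

  spread-far : ∀ a → Far a → Spread a
  spread-far a fa with kind a in eq
  ... | notFar ¬fa = ⊥-elim (¬fa fa)
  ... | mixed x y nx ny ax ay o = far , f x ,
        short far (λ s → inner s ∷ outer s ∷ []) (f x) (near⇒adj nx ∷ flip ax ∷ [])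
          (col-centre x nx refl ◂ col-plain x a nx fa (cong (λ k → twist k x) eq) refl ◂ refl) ,
        long far (λ s → inner (not s) ∷ outer (not s) ∷ []) (f x) (near⇒adj ny ∷ flip ay ∷ [])
          (col-centre y ny o ◂ col-plain y a ny fa (cong (λ k → twist k y) eq) o ◂ refl)
  ... | linked x b y nx fb ny ax ab by o mono with untwisted fb ny by
  ...   | y′ , ny′ , by′ , o′ , t = far , f x ,
        short far (λ s → inner s ∷ outer s ∷ []) (f x) (near⇒adj nx ∷ flip ax ∷ [])
          (col-centre x nx refl ◂ col-plain x a nx fa (cong (λ k → twist k x) eq) refl ◂ refl) ,
        long far (λ s → inner (not s) ∷ outer (not s) ∷ mid ∷ []) (f x)
          (near⇒adj ny′ ∷ flip by′ ∷ flip ab ∷ [])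
          (col-centre y′ ny′ (trans o′ o) ◂ col-plain y′ b ny′ fb t (trans o′ o) ◂ col-far b a fb fa ◂ refl)
  -- The edge from `x` keeps its colour and ends the short route; the switched edge from `x′` ends
  -- the long one, outside the palette of this side.
  spread-far a fa | doubled x x′ y x≢x′ nx nx′ ny ax ax′ x′y o mono = far , f x ,
        short far (λ s → inner s ∷ outer s ∷ []) (f x) (near⇒adj nx ∷ flip ax ∷ [])
          (col-centre x nx refl ◂
           col-plain x a nx fa (trans (cong (λ k → twist k x) eq) (dec-false (x ≟ x′) x≢x′)) refl ◂ refl) ,
        long far (λ s → inner (not s) ∷ mid ∷ outer (not s) ∷ []) (f x)
          (near⇒adj ny ∷ flip x′y ∷ flip ax′ ∷ [])
          (col-centre y ny o ◂ col-near y x′ ny nx′ ◂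
           col-twisted x′ a nx′ fa (trans (cong (λ k → twist k x′) eq) (dec-true (x′ ≟ x′) refl)) (mono nx′ ax′) ◂
           refl)

  spread : ∀ u → Spread u
  spread u with classify u
  ... | inj₁ refl = centre , false , ([] , [] , []) , ([] , [] , [])
  ... | inj₂ (inj₁ nu) = spread-near u nu
  ... | inj₂ (inj₂ fu) = spread-far u fu

  rainbow-connecting : RainbowConnecting c
  rainbow-connecting u w _ with spread u | spread w
  ... | l , s , (p , rp , ap) , (p′ , rp′ , ap′) | m , t , (q , rq , aq) , (q′ , rq′ , aq′) with t ≟ᵇ s
  ... | no t≢s = connect c p q rp rq ap aq λ x∈ x∈′ →
        palette-far-disjoint s
          (palette-⊆-far l s x∈ , subst (λ b → _ ∈ palette far b) (¬-not t≢s) (palette-⊆-far m t x∈′))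
  ... | yes refl with palette-total l m s
  ...   | inj₁ l⊆m = connect c p q′ rp rq′ ap aq′ λ x∈ x∉ → x∉ (l⊆m x∈)
  ...   | inj₂ m⊆l = connect c p′ q rp′ rq ap′ aq λ x∉ x∈ → x∉ (m⊆l x∈)

  rc≤5 : RcLe G 5
  rc≤5 = c , rainbow-connecting

-- Maximal closed neighbourhoods, common neighbours and bridges.

maximal : ∀ {m n} (h : Fin m → Subset n) → Fin m → ∃[ v ] ∀ x → ¬ h v ⊂ h x
maximal h u = climb u (⊃-wellFounded (h u))
  where
  climb : ∀ v → Acc _⊃_ (h v) → ∃[ v ] ∀ x → ¬ h v ⊂ h x
  climb v (acc rec) with any? (λ x → h v ⊂? h x)
  ... | yes (x , v⊂x) = climb x (rec v⊂x)
  ... | no none       = v , λ x v⊂x → none (x , v⊂x)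

module _ (G : Graph) where

  adj? : ∀ u w → Dec (Adj G u w)
  adj? u w = adj G u w ≟ᵇ true

  closed? : ∀ u → Decidable₁ (λ w → w ≡ u ⊎ Adj G u w)
  closed? u w = (w ≟ u) ⊎-dec adj? u w

  closed : Vertex G → Subset (n G)
  closed u = tabulate (λ w → does (closed? u w))

  ∈closed⁺ : ∀ {u w} → w ≡ u ⊎ Adj G u w → w ∈ˢ closed u
  ∈closed⁺ {u} {w} e = lookup⇒[]= w _ (trans (lookup∘tabulate _ w) (dec-true (closed? u w) e))

  ∈closed⁻ : ∀ {u w} → w ∈ˢ closed u → w ≡ u ⊎ Adj G u w
  ∈closed⁻ {u} {w} m = decidable-stable (closed? u w) λ ¬e →
    case trans (≡-sym (dec-false (closed? u w) ¬e))
               (trans (≡-sym (lookup∘tabulate (does ∘ closed? u) w)) ([]=⇒lookup m)) of λ ()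

  commonNeighbour : (∀ u w → DistLe G u w 2) → ∀ {u w} → u ≢ w → ¬ Adj G u w → ∃[ c ] Adj G u c × Adj G c w
  commonNeighbour dist {u} {w} u≢w ¬uw with dist u w
  ... | [] , _ , _                             = ⊥-elim (u≢w refl)
  ... | e ∷ [] , _ , _                         = ⊥-elim (¬uw e)
  ... | e ∷ e′ ∷ [] , _ , _                    = _ , e , e′
  ... | _ ∷ _ ∷ _ ∷ _ , _ , s≤s (s≤s ())

  removed-adj : ∀ {u x w} → Adj (removeEdge G u x) x w → w ≢ u × Adj G x w
  removed-adj {u} {x} {w} e with w ≟ u
  removed-adj {u} {x} {w} e | yes refl with adj G x w | x ≟ w | w ≟ x | x ≟ x
  ... | _     | _        | _     | no x≢x = ⊥-elim (x≢x refl)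
  removed-adj {u} {x} {w} () | yes refl | false | _ | _ | yes _
  removed-adj {u} {x} {w} () | yes refl | true | yes _ | yes _ | yes _
  removed-adj {u} {x} {w} () | yes refl | true | yes _ | no _ | yes _
  removed-adj {u} {x} {w} () | yes refl | true | no _ | _ | yes _
  removed-adj {u} {x} {w} e | no w≢u with adj G x w
  ... | true = w≢u , refl

  -- If `u` were the only neighbour of `x`, deleting the edge between them would isolate `x`, so it
  -- would be a bridge.
  secondNeighbour : Bridgeless G → ∀ {u x} → Adj G u x → ∃[ w ] w ≢ u × Adj G x w
  secondNeighbour bl {u} {x} ux with any? (λ w → ¬? (w ≟ u) ×-dec adj? x w)
  ... | yes found = found
  ... | no none   = ⊥-elim (bl u x (ux , λ conn → stuck (proj₁ (conn x u))))
    where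
    stuck : ¬ Walk (removeEdge G u x) x u
    stuck []      = adj⇒≢ G ux refl
    stuck (e ∷ _) = none (_ , removed-adj e)

-- Splitting the neighbours of the centre.

module Partition (G : Graph) (bl : Bridgeless G) (dist : ∀ u w → DistLe G u w 2)
                 (v : Vertex G) (v-max : ∀ x → ¬ closed G v ⊂ closed G x) where

  open Distance G v

  common : ∀ {u w} → u ≢ w → ¬ Adj G u w → ∃[ c ] Adj G u c × Adj G c w
  common = commonNeighbour G dist

  near≢far : ∀ {x a} → Near x → Far a → x ≢ a
  near≢far nx fa refl = case trans (≡-sym nx) fa of λ ()

  far-neighbour : ∀ {a c} → Far a → Adj G a c → Near c ⊎ Far c
  far-neighbour {a} {c} fa ac with classify c
  ... | inj₁ refl = ⊥-elim (far⇒¬adj fa (adj-sym G ac))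
  ... | inj₂ nf   = nf

  -- Otherwise the closed neighbourhood of `x` would contain that of `v`, strictly because of `a`,
  -- against maximality.
  nonNeighbour : ∀ {x a} → Near x → Far a → Adj G x a → ∃[ u ] Near u × u ≢ x × ¬ Adj G x u
  nonNeighbour {x} {a} nx fa xa with any? (λ u → (u ≟ˡ near) ×-dec ¬? (u ≟ x) ×-dec ¬? (adj? G x u))
  ... | yes found = found
  ... | no none   = ⊥-elim (v-max x (v⊆x , a , ∈closed⁺ G (inj₂ xa) , a∉v))
    where
    adjacent : ∀ {w} → w ≡ v ⊎ Adj G v w → w ≡ x ⊎ Adj G x w
    adjacent (inj₁ refl) = inj₂ (adj-sym G (near⇒adj nx))
    adjacent {w} (inj₂ vw) with w ≟ x | adj? G x w
    ... | yes w≡x | _      = inj₁ w≡x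
    ... | no _    | yes xw = inj₂ xw
    ... | no w≢x  | no ¬xw = ⊥-elim (none (w , adj⇒near vw , w≢x , ¬xw))
    v⊆x : ∀ {w} → w ∈ˢ closed G v → w ∈ˢ closed G x
    v⊆x = ∈closed⁺ G ∘ adjacent ∘ ∈closed⁻ G
    a∉v : ¬ a ∈ˢ closed G v
    a∉v m with ∈closed⁻ G m
    ... | inj₁ a≡v = far⇒≢ fa a≡v
    ... | inj₂ va  = far⇒¬adj fa va

  -- The second neighbour given by bridgelessness must be near here, so no near vertex is isolated
  -- in the graph induced on them, and its bipartition provides an opposite neighbour.
  rc-noFar : (∀ a → ¬ Far a) → RcLe G 5
  rc-noFar none = Routes.rc≤5 G v f (λ a → Sides.notFar (none a)) opp
    where
    R : Vertex G → Vertex G → Set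
    R u w = Near u × Near w × Adj G u w
    split : _
    split = bipartition R (λ (nu , nw , e) → nw , nu , adj-sym G e) (λ { refl (_ , _ , e) → adj⇒≢ G e refl })
              (λ u w → (u ≟ˡ near) ×-dec (w ≟ˡ near) ×-dec adj? G u w)
    f : Vertex G → Bool
    f = proj₁ split
    opp : ∀ x → Near x → (∃[ y ] Near y × Adj G x y × f y ≡ not (f x)) ⊎ (∃[ a ] Far a × Adj G x a)
    opp x nx with secondNeighbour G bl (near⇒adj nx)
    ... | w , w≢v , xw with classify w
    ...   | inj₁ w≡v       = ⊥-elim (w≢v w≡v)
    ...   | inj₂ (inj₂ fw) = ⊥-elim (none w fw)
    ...   | inj₂ (inj₁ nw) = let y , (_ , ny , xy) , o = proj₂ split (nx , nw , xw) in inj₁ (y , ny , xy , o)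

  Touching : Vertex G → Set
  Touching u = Near u × ∃[ a ] Far a × Adj G u a

  touching? : Decidable₁ Touching
  touching? u = (u ≟ˡ near) ×-dec any? (λ a → (a ≟ˡ far) ×-dec adj? G u a)

  Apart : Vertex G → Vertex G → Set
  Apart u w = u ≢ w × ¬ Adj G u w

  apart? : Decidable Apart
  apart? u w = ¬? (u ≟ w) ×-dec ¬? (adj? G u w)

  -- `apart` handles far vertices with a single near neighbour, `surject` those with at least two.
  record Split : Set where
    field
      side     : Vertex G → Bool
      apart    : ∀ {x u} → Touching x → Touching u → Apart x u →
                 ∃[ w ] Touching w × Apart x w × side w ≡ not (side x)
      surject  : ∀ {x u} → Touching x → Touching u → x ≢ u → ∀ s → ∃[ w ] Touching w × side w ≡ s

  module _ (Q : Vertex G → Vertex G → Set) (Q-sym : Symmetric Q) (Q? : Decidable Q)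
           (Q⇒≢ : ∀ {u w} → Q u w → u ≢ w) where

    R : Vertex G → Vertex G → Set
    R u w = Touching u × Touching w × Q u w

    split : Σ (Vertex G → Bool) λ f → ∀ {u w} → R u w → ∃[ x ] R u x × f x ≡ not (f u)
    split = bipartition R (λ (tu , tw , q) → tw , tu , Q-sym q) (λ { refl (_ , _ , q) → Q⇒≢ q refl })
              (λ u w → touching? u ×-dec touching? w ×-dec Q? u w)

    split-surject : ∀ {u w} → R u w → ∀ s → ∃[ x ] Touching x × proj₁ split x ≡ s
    split-surject {u} r s with proj₁ split u ≟ᵇ s
    ... | yes fu≡s = u , proj₁ r , fu≡s
    ... | no  fu≢s = let x , (_ , tx , _) , o = proj₂ split r in
                     x , tx , trans o (≡-sym (¬-not (≢-sym fu≢s)))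

  -- If two touching vertices are non-adjacent, the bipartition for non-adjacency has a pair across,
  -- hence both sides occur. Otherwise the touching vertices form a clique, `apart` is vacuous, and
  -- splitting by inequality suffices.
  touching-split : Split
  touching-split with any? (λ t → any? (λ u → touching? t ×-dec touching? u ×-dec apart? t u))
  ... | yes (t , u , r) = record
    { side    = proj₁ sp
    ; apart   = λ tx tu a → let w , (_ , tw , a′) , o = proj₂ sp (tx , tu , a) in w , tw , a′ , o
    ; surject = λ _ _ _ → split-surject Apart apart-sym apart? proj₁ r
    }
    where
    apart-sym : Symmetric Apart
    apart-sym (u≢w , ¬uw) = ≢-sym u≢w , ¬uw ∘ adj-sym G
    sp : _
    sp = split Apart apart-sym apart? proj₁
  ... | no clique = record
    { side    = proj₁ (split _≢_ ≢-sym ≢? id)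
    ; apart   = λ tx tu a → ⊥-elim (clique (_ , _ , tx , tu , a))
    ; surject = λ tx tu x≢u → split-surject _≢_ ≢-sym ≢? id (tx , tu , x≢u)
    }
    where
    ≢? : Decidable _≢_
    ≢? u w = ¬? (u ≟ w)

  -- Extending the split and classifying far vertices.

  module _ (z : Vertex G) (fz : Far z) where

    open Split touching-split

    -- The common neighbour of `u` and `z` is not `v`, as `z` is far, and not far, as `u` touches no
    -- far vertex. So it is near and touches `z`.
    touching-neighbour : ∀ {u} → Near u → ¬ Touching u → ∃[ t ] Touching t × Adj G u t
    touching-neighbour {u} nu ¬tu with common (near≢far nu fz) (λ uz → ¬tu (nu , z , fz , uz))
    ... | t , ut , tz with far-neighbour fz (adj-sym G tz)
    ...   | inj₁ nt = t , (nt , z , fz , tz) , ut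
    ...   | inj₂ ft = ⊥-elim (¬tu (nu , t , ft , ut))

    extend : ∀ u → Σ Bool λ b → (Touching u → b ≡ side u) ×
                   (Near u → ¬ Touching u → ∃[ t ] Touching t × Adj G u t × side t ≡ not b)
    extend u with touching? u | u ≟ˡ near
    ... | yes tu | _      = side u , (λ _ → refl) , λ _ ¬tu → ⊥-elim (¬tu tu)
    -- An arbitrary default: only the sides of near vertices matter.
    ... | no ¬tu | no ¬nu = false , (λ tu → ⊥-elim (¬tu tu)) , λ nu → ⊥-elim (¬nu nu)
    ... | no ¬tu | yes nu = let t , tt , ut = touching-neighbour nu ¬tu in
                            not (side t) , (λ tu → ⊥-elim (¬tu tu)) ,
                            λ _ _ → t , tt , ut , ≡-sym (not-involutive (side t))

    f : Vertex G → Bool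
    f = proj₁ ∘ extend

    f-touching : ∀ {u} → Touching u → f u ≡ side u
    f-touching {u} = proj₁ (proj₂ (extend u))

    open Sides G v f using (Kind; notFar; mixed; linked; doubled; Opposite; Monochromatic)

    opp : ∀ x → Near x → (∃[ y ] Near y × Adj G x y × Opposite y x) ⊎ (∃[ a ] Far a × Adj G x a)
    opp x nx = decide (touching? x)
      where
      decide : Dec (Touching x) → _
      decide (yes (_ , a)) = inj₂ a
      decide (no ¬tx) = let t , tt , xt , o = proj₂ (proj₂ (extend x)) nx ¬tx in
                        inj₁ (t , proj₁ tt , xt , trans (f-touching tt) o)

    mixed? : ∀ a x → Dec (∃[ y ] Near y × Adj G a y × Opposite y x)
    mixed? a x = any? λ y → (y ≟ˡ near) ×-dec adj? G a y ×-dec (f y ≟ᵇ not (f x))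

    linked? : ∀ a x → Dec (∃[ b ] ∃[ y ] Far b × Near y × Adj G a b × Adj G b y × Opposite y x)
    linked? a x = any? λ b → any? λ y →
      (b ≟ˡ far) ×-dec (y ≟ˡ near) ×-dec adj? G a b ×-dec adj? G b y ×-dec (f y ≟ᵇ not (f x))

    kind : ∀ a → Kind a
    kind a with a ≟ˡ far
    ... | no ¬fa = notFar ¬fa
    ... | yes fa with common (≢-sym (far⇒≢ fa)) (far⇒¬adj fa)
    ... | x , vx , xa with mixed? a x
    ... | yes (y , ny , ay , o) = mixed x y (adj⇒near vx) ny (adj-sym G xa) ay o
    ... | no ¬mixed with linked? a x
    ... | yes (b , y , fb , ny , ab , by , o) =
          linked x b y (adj⇒near vx) fb ny (adj-sym G xa) ab by o
            (λ {w} nw aw → trans (¬-not (λ o′ → ¬mixed (w , nw , aw , o′))) (not-involutive _))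
    ... | no ¬linked = unlinked
      where
      nx : Near x
      nx = adj⇒near vx

      tx : Touching x
      tx = nx , a , fa , xa

      mono : Monochromatic a (f x)
      mono {w} nw aw = trans (¬-not (λ o → ¬mixed (w , nw , aw , o))) (not-involutive _)

      -- The middle vertex of a path of length 2 from `a` to `y` is not `v`, and if it were far then
      -- `a` would be `linked`.
      reach : ∀ {y} → Near y → Opposite y x → ∃[ x′ ] Near x′ × Adj G a x′ × Adj G x′ y
      reach {y} ny o with common (≢-sym (near≢far ny fa)) (λ ay → ¬mixed (y , ny , ay , o))
      ... | c , ac , cy with far-neighbour fa ac
      ...   | inj₁ nc = c , nc , ac , cy
      ...   | inj₂ fc = ⊥-elim (¬linked (c , y , fc , ny , ac , cy , o))

      two : ∀ x₁ → Near x₁ → Adj G a x₁ → x₁ ≢ x → Kind a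
      two x₁ nx₁ ax₁ x₁≢x with surject tx (nx₁ , a , fa , adj-sym G ax₁) (≢-sym x₁≢x) (not (f x))
      ... | y , ty , sy with reach (proj₁ ty) (trans (f-touching ty) sy)
      ... | x′ , nx′ , ax′ , x′y with x ≟ x′
      ...   | no x≢x′  = doubled x x′ y x≢x′ nx nx′ (proj₁ ty) (adj-sym G xa) ax′ x′y
                           (trans (f-touching ty) sy) mono
      -- If `x` itself is adjacent to `y`, its edge to `a` is the one switched, and `x₁` takes over
      -- the plain role.
      ...   | yes refl = doubled x₁ x y x₁≢x nx₁ nx (proj₁ ty) ax₁ ax′ x′y
                           (trans (trans (f-touching ty) sy) (cong not (≡-sym (mono nx₁ ax₁))))
                           (λ nw aw → trans (mono nw aw) (≡-sym (mono nx₁ ax₁)))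

      -- A common neighbour of `a` and the non-neighbour `u` of `x` cannot be near, since it would
      -- be `x`; so it is far and `u` is touching. Then `apart` gives an opposite `w` not adjacent
      -- to `x`, while `reach` makes `x`, the only candidate, adjacent to `w`.
      one : (∀ {w} → Near w → Adj G a w → w ≡ x) → ⊥
      one unique with nonNeighbour nx fa xa
      ... | u , nu , u≢x , ¬xu with common (≢-sym (near≢far nu fa)) (λ au → u≢x (unique nu au))
      ... | c , ac , cu with far-neighbour fa ac
      ... | inj₁ nc with unique nc ac
      ...   | refl = ¬xu cu
      one unique | u , nu , u≢x , ¬xu | c , ac , cu | inj₂ fc
        with apart tx (nu , c , fc , adj-sym G cu) (≢-sym u≢x , ¬xu)
      ... | w , tw , (_ , ¬xw) , o
        with reach (proj₁ tw) (trans (f-touching tw) (trans o (cong not (≡-sym (f-touching tx)))))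
      ... | x′ , nx′ , ax′ , x′w with unique nx′ ax′
      ...   | refl = ¬xw x′w

      unlinked : Kind a
      unlinked with any? (λ x₁ → (x₁ ≟ˡ near) ×-dec adj? G a x₁ ×-dec ¬? (x₁ ≟ x))
      ... | yes (x₁ , nx₁ , ax₁ , x₁≢x) = two x₁ nx₁ ax₁ x₁≢x
      ... | no none = ⊥-elim (one λ {w} nw aw → decidable-stable (w ≟ x) λ w≢x → none (w , nw , aw , w≢x))

    rc-far : RcLe G 5
    rc-far = Routes.rc≤5 G v f kind opp

  rc≤5 : RcLe G 5
  rc≤5 with any? (_≟ˡ far)
  ... | yes (z , fz) = rc-far z fz
  ... | no none      = rc-noFar (λ a fa → none (a , fa))

theorem8 : (G : Graph) → Bridgeless G → HasDiameter G 2 → RcLe G 5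
theorem8 G bl (_ , dist , u , _) =
  -- An endpoint of a pair at distance 2 serves as the starting vertex of the climb.
  let v , v-max = maximal (closed G) u in Partition.rc≤5 G bl dist v v-max
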